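{- Let $G$ be a $2t$-regular graph of order $n$ that admits a neighborhood balanced coloring and that admits a local distance antimagic labeling, and let $H$ be an $r$-regular graph of order $m$. Then $\chi_{ld}(G\times H)\leq \chi_{ld}(G)$.
   Context: All graphs are finite, simple, undirected and without isolated vertices. For a graph $G$ of order $n$ and a bijection $f\colon V(G)\to\{1,2,\dots,n\}$, the weight of a vertex $u$ is $w_f(u)=\sum_{x\in N(u)}f(x)$, where $N(u)$ is the open neighborhood of $u$. The bijection $f$ is a local distance antimagic labeling of $G$ if $w_f(u)\neq w_f(v)$ for every edge $uv$ of $G$. The local distance antimagic chromatic number $\chi_{ld}(G)$ is the minimum number of distinct weights over all local distance antimagic labelings of $G$ (an upper bound on $\chi_{ld}$ includes the assertion that such a labeling exists). A neighborhood balanced coloring of a graph is an assignment of one of two colors to each vertex (not necessarily proper) such that every vertex has equally many neighbors of each color. The direct product $G\times H$ has vertex set $V(G)\times V(H)$, with $(g,h)$ and $(g',h')$ adjacent iff $gg'\in E(G)$ and $hh'\in E(H)$. -}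

module Defs where

open import Data.Bool.Base using (Bool; true; false)
import Data.Bool.Properties as Bool
open import Data.Fin.Base using (Fin; toℕ)
open import Data.Fin.Properties using (*↔×)
open import Data.List.Base using (List; length; map; filter; allFin; deduplicate)
open import Data.Nat.Base using (ℕ; suc; _*_; _≤_)
open import Data.Nat.ListAction using (sum)
import Data.Nat.Properties as ℕ
open import Data.Product.Base using (∃; ∃-syntax; _×_; _,_; proj₁; proj₂)
open import Data.Product.Function.NonDependent.Propositional using (_×-↔_)
open import Function.Bundles using (_↔_; _⤖_; Inverse; Bijection)
open import Function.Construct.Composition using (_↔-∘_)
open import Function.Construct.Symmetry using (↔-sym)
open import Relation.Binary.Definitions using (Decidable; Symmetric; Irreflexive)
open import Relation.Binary.PropositionalEquality.Core using (_≡_; _≢_; refl)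
open import Relation.Nullary.Decidable using (_×-dec_)

-- Graphs are simple, undirected, of finite order n, and have no isolated
-- vertices.  The enumeration of V only serves to compute sums and
-- cardinalities, none of which depend on its choice.

record Graph (n : ℕ) : Set₁ where
  field
    V          : Set
    enumerate  : V ↔ Fin n
    Adj        : V → V → Set
    adj?       : Decidable Adj
    adj-sym    : Symmetric Adj
    adj-irrefl : Irreflexive _≡_ Adj
    noIsolated : ∀ u → ∃[ v ] Adj u v

  vertices : List V
  vertices = map (Inverse.from enumerate) (allFin n)

  neighbours : V → List V
  neighbours u = filter (adj? u) vertices

  degree : V → ℕ
  degree u = length (neighbours u)

open Graph using (V)

Regular : ∀ {n} → ℕ → Graph n → Set
Regular k G = ∀ u → degree u ≡ k
  where open Graph G using (degree)

infixr 7 _×ᴳ_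

-- The direct (tensor) product.

_×ᴳ_ : ∀ {n m} → Graph n → Graph m → Graph (n * m)
G ×ᴳ H = record
  { V          = G.V × H.V
  ; enumerate  = ↔-sym *↔× ↔-∘ (G.enumerate ×-↔ H.enumerate)
  ; Adj        = λ (g , h) (g′ , h′) → G.Adj g g′ × H.Adj h h′
  ; adj?       = λ (g , h) (g′ , h′) → G.adj? g g′ ×-dec H.adj? h h′
  ; adj-sym    = λ (a , b) → G.adj-sym a , H.adj-sym b
  ; adj-irrefl = λ { refl (a , _) → G.adj-irrefl refl a }
  ; noIsolated = λ (g , h) →
      (proj₁ (G.noIsolated g) , proj₁ (H.noIsolated h)) ,
      (proj₂ (G.noIsolated g) , proj₂ (H.noIsolated h))
  }
  where
  module G = Graph G
  module H = Graph H

module _ {n : ℕ} (G : Graph n) where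
  open Graph G hiding (V)

  -- The two colors are true and false.
  NeighbourhoodBalanced : (V G → Bool) → Set
  NeighbourhoodBalanced c = ∀ u → number true u ≡ number false u
    where
    number : Bool → V G → ℕ
    number b u = length (filter (λ x → c x Bool.≟ b) (neighbours u))

  HasNeighbourhoodBalancedColoring : Set
  HasNeighbourhoodBalancedColoring = ∃ NeighbourhoodBalanced

  Labeling : Set
  Labeling = V G ⤖ Fin n

  -- Fin n stands for {1, …, n}: the element i represents the label 1 + i.
  label : Labeling → V G → ℕ
  label f x = suc (toℕ (Bijection.to f x))

  weight : Labeling → V G → ℕ
  weight f u = sum (map (label f) (neighbours u))

  LocalDistanceAntimagic : Labeling → Set
  LocalDistanceAntimagic f = ∀ {u v} → Adj u v → weight f u ≢ weight f v

  HasLocalDistanceAntimagicLabeling : Set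
  HasLocalDistanceAntimagicLabeling = ∃ LocalDistanceAntimagic

  numberOfWeights : Labeling → ℕ
  numberOfWeights f = length (deduplicate ℕ._≟_ (map (weight f) vertices))

-- χld G ≔ k says that χ_ld(G) is defined and equals k.  The minimum is
-- given as a relation because it is undefined when G has no local distance
-- antimagic labeling; there is at most one such k.

record χld_≔_ {n : ℕ} (G : Graph n) (k : ℕ) : Set where
  field
    attained   : ∃[ f ] LocalDistanceAntimagic G f × numberOfWeights G f ≡ k
    lowerBound : ∀ f → LocalDistanceAntimagic G f → k ≤ numberOfWeights G f

{-# OPTIONS --safe #-}
-- Order the vertices of H by j : V(H) → {0, …, m−1}.  A labeling f of G and a
-- balanced coloring of G give the labeling of G × H with value
-- m (f v − 1) + j h + 1 at (v , h) if v has the first color, and with j h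
-- replaced by m − 1 − j h if v has the second one.  Since every vertex of G has
-- t neighbours of each color, the contributions of j add up to a constant, and
-- the weight of (u , h) is r m w_f(u) plus a constant.  Hence the labeling is
-- local distance antimagic as soon as f is, and has no more weights than f.
--
-- Constructively, the minimum defining χ_ld exists because one can search all
-- labelings, viewed up to pointwise equality as bijections Fin n → Fin n.
module Submission where

open import Defs
open import Data.Bool.Base using (Bool; true; false; if_then_else_)
import Data.Bool.Properties as Bool
open import Data.Fin.Base using (Fin; zero; suc; toℕ; combine; opposite)
open import Data.Fin.Properties as Fin
  using (any?; all?; combine-injective; combine-surjective; toℕ-combine;
         opposite-prop; opposite-involutive; toℕ<n; nonZeroIndex)
open import Data.List.Base
  using (List; []; _∷_; _++_; length; map; filter; deduplicate;
         cartesianProduct)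
open import Data.List.Membership.Propositional using (_∈_)
open import Data.List.Membership.Propositional.Properties
  using (∈-map⁺; ∈-map⁻; ∈-allFin; ∈-filter⁺; ∈-filter⁻; ∈-deduplicate⁺;
         ∈-deduplicate⁻; ∈-cartesianProduct⁺; ∈-cartesianProduct⁻)
open import Data.List.Membership.Propositional.Properties.WithK
  using (unique∧set⇒bag)
open import Data.List.Properties using (map-++; map-∘; map-cong; length-map; filter-notAll)
open import Data.List.Relation.Binary.BagAndSetEquality using (∼bag⇒↭)
open import Data.List.Relation.Binary.Permutation.Propositional using (_↭_)
import Data.List.Relation.Binary.Permutation.Propositional.Properties as ↭
open import Data.List.Relation.Binary.Subset.Propositional using (_⊆_)
import Data.List.Relation.Unary.All as All
import Data.List.Relation.Unary.Any as Any
open import Data.List.Relation.Unary.AllPairs using ([]; _∷_)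
open import Data.List.Relation.Unary.Any using (here; there)
open import Data.List.Relation.Unary.Unique.Propositional using (Unique)
import Data.List.Relation.Unary.Unique.Propositional.Properties as Unique
import Data.List.Relation.Unary.Unique.DecPropositional.Properties as DecUnique
open import Data.Nat.Base using (ℕ; zero; suc; _+_; _*_; _∸_; _≤_; z≤n; s≤s; NonZero)
open import Data.Nat.ListAction using (sum)
open import Data.Nat.ListAction.Properties using (sum-++; sum-↭)
open import Data.Nat.Properties as ℕ
  using (≤-trans; +-suc; *-zeroʳ; +-identityʳ; *-distribˡ-+; *-cancelˡ-≡; +-cancelʳ-≡;
         m+n∸n≡m; m+[n∸m]≡n; m*n≢0)
open import Data.Nat.Tactic.RingSolver using (solve-∀)
open import Data.Product.Base using (∃; ∃-syntax; _×_; _,_; proj₁; proj₂)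
open import Data.Vec.Functional as Vector using (Vector)
open import Function.Base using (_∘_; _$_)
open import Function.Bundles using (Inverse; Bijection; mk⤖; mk⇔)
open import Function.Consequences.Propositional
  using (strictlySurjective⇒surjective; surjective⇒strictlySurjective)
open import Function.Construct.Composition using (_⤖-∘_)
open import Function.Definitions using (Bijective; Injective; StrictlySurjective)
open import Function.Properties.Inverse using (↔⇒⤖; ↔-sym)
open import Relation.Binary.Definitions using (DecidableEquality)
open import Relation.Binary.PropositionalEquality
  using (_≡_; _≢_; _≗_; refl; sym; trans; cong; cong₂; subst; module ≡-Reasoning)
open import Relation.Nullary.Decidable using (Dec; yes; no; map′; _×-dec_; _→-dec_; ¬?)
open import Relation.Nullary.Negation using (contradiction)
open import Relation.Unary using (Decidable)

-- Sums over lists, and counting by color or by inclusion.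

module _ {A : Set} where

  sum-map-+ : ∀ (f g : A → ℕ) xs →
    sum (map (λ x → f x + g x) xs) ≡ sum (map f xs) + sum (map g xs)
  sum-map-+ f g []       = refl
  sum-map-+ f g (x ∷ xs) = trans
    (cong (f x + g x +_) (sum-map-+ f g xs))
    (interchange (f x) (g x) (sum (map f xs)) (sum (map g xs)))
    where
    interchange : ∀ a b c d → a + b + (c + d) ≡ a + c + (b + d)
    interchange = solve-∀

  sum-map-* : ∀ k (f : A → ℕ) xs → sum (map (λ x → k * f x) xs) ≡ k * sum (map f xs)
  sum-map-* k f []       = sym (*-zeroʳ k)
  sum-map-* k f (x ∷ xs) = trans
    (cong (k * f x +_) (sum-map-* k f xs))
    (sym (*-distribˡ-+ k (f x) (sum (map f xs))))

  sum-map-const : ∀ k (xs : List A) → sum (map (λ _ → k) xs) ≡ length xs * k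
  sum-map-const k []       = refl
  sum-map-const k (x ∷ xs) = cong (k +_) (sum-map-const k xs)

  sum-map-cong : ∀ {f g : A → ℕ} → f ≗ g → ∀ xs → sum (map f xs) ≡ sum (map g xs)
  sum-map-cong f≗g = cong sum ∘ map-cong f≗g

  colored : (A → Bool) → Bool → List A → List A
  colored c b = filter (λ x → c x Bool.≟ b)

  length-colored : ∀ c xs →
    length xs ≡ length (colored c true xs) + length (colored c false xs)
  length-colored c []       = refl
  length-colored c (x ∷ xs) with c x
  ... | true  = cong suc (length-colored c xs)
  ... | false = trans (cong suc (length-colored c xs)) (sym (+-suc _ _))

  -- Collects equal terms by color, so that a balanced list later gives both values of `s` the same
  -- coefficient.
  sum-map-colored : ∀ (c : A → Bool) (s : Bool → ℕ) xs → sum (map (s ∘ c) xs) ≡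
    length (colored c true xs) * s true + length (colored c false xs) * s false
  sum-map-colored c s []       = refl
  sum-map-colored c s (x ∷ xs) with c x
  ... | true  = trans (cong (s true +_) (sum-map-colored c s xs))
                      (assoc (s true) _ _)
    where
    assoc : ∀ a p q → a + (p + q) ≡ a + p + q
    assoc = solve-∀
  ... | false = trans (cong (s false +_) (sum-map-colored c s xs))
                      (comm (s false) (length (colored c true xs) * s true) _)
    where
    comm : ∀ a p q → a + (p + q) ≡ p + (a + q)
    comm = solve-∀

  -- Induction on `xs`: removing the head `x` from `ys` shortens `ys` strictly, and the tail of
  -- `xs`, which avoids `x`, stays inside what is left.
  unique-⊆⇒length-≤ : DecidableEquality A → ∀ {xs ys : List A} →
    Unique xs → xs ⊆ ys → length xs ≤ length ys
  unique-⊆⇒length-≤ _≟_ []                    _     = z≤n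
  unique-⊆⇒length-≤ _≟_ {x ∷ _} {ys} (x∉ ∷ u) xs⊆ys = ≤-trans
    (s≤s (unique-⊆⇒length-≤ _≟_ u λ z∈ → ∈-filter⁺ ≢x? (xs⊆ys (there z∈)) (All.lookup x∉ z∈)))
    (filter-notAll ≢x? ys (Any.map (λ x≡y x≢y → x≢y x≡y) (xs⊆ys (here refl))))
    where
    ≢x? : Decidable (x ≢_)
    ≢x? y = ¬? (x ≟ y)

  sum-map-cartesianProduct : ∀ {B : Set} (f : A × B → ℕ) xs ys →
    sum (map f (cartesianProduct xs ys)) ≡ sum (map (λ x → sum (map (λ y → f (x , y)) ys)) xs)
  sum-map-cartesianProduct f []       ys = refl
  sum-map-cartesianProduct f (x ∷ xs) ys = begin
    sum (map f (map (x ,_) ys ++ cartesianProduct xs ys))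
      ≡⟨ cong sum (map-++ f (map (x ,_) ys) _) ⟩
    sum (map f (map (x ,_) ys) ++ map f (cartesianProduct xs ys))
      ≡⟨ sum-++ (map f (map (x ,_) ys)) _ ⟩
    sum (map f (map (x ,_) ys)) + sum (map f (cartesianProduct xs ys))
      ≡⟨ cong₂ _+_ (cong sum (sym (map-∘ ys))) (sum-map-cartesianProduct f xs ys) ⟩
    sum (map (λ y → f (x , y)) ys) + sum (map (λ x → sum (map (λ y → f (x , y)) ys)) xs) ∎
    where open ≡-Reasoning

-- Decidable search: least numbers, functions between finite sets, bijections.

least : ∀ {P : ℕ → Set} → Decidable P → ∀ k → P k → ∃[ l ] P l × (∀ j → P j → l ≤ j)
least P? zero    p = zero , p , λ _ _ → z≤n
least P? (suc k) p with P? zero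
... | yes p₀ = zero , p₀ , λ _ _ → z≤n
... | no ¬p₀ with least (P? ∘ suc) k p
...   | l , pl , l-min = suc l , pl , λ where
        zero    p₀ → contradiction p₀ ¬p₀
        (suc j) pj → s≤s (l-min j pj)

-- Tries every value at `zero` and recurses on the tail. A function is only pointwise equal to its
-- head followed by its tail, so `P` has to respect `_≗_`.
anyVector? : ∀ {k} n {P : Vector (Fin k) n → Set} →
  (∀ {f g} → f ≗ g → P f → P g) → Decidable P → Dec (∃ P)
anyVector? zero    resp P? = map′ (_ ,_) (λ (_ , p) → resp (λ ()) p) (P? λ ())
anyVector? (suc n) resp P? = map′
  (λ (i , f , p) → i Vector.∷ f , p)
  (λ (f , p) → Vector.head f , Vector.tail f , resp (λ { zero → refl ; (suc _) → refl }) p)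
  (any? λ i → anyVector? n
    (λ f≗g → resp λ { zero → refl ; (suc j) → f≗g j })
    (λ f → P? (i Vector.∷ f)))

bijective? : ∀ {k n} (f : Fin n → Fin k) → Dec (Bijective _≡_ _≡_ f)
bijective? f = map′
  (λ (inj , sur) → (λ {i} {j} → inj i j) , strictlySurjective⇒surjective sur)
  (λ (inj , sur) → (λ i j → inj) , surjective⇒strictlySurjective sur)
  ((all? λ i → all? λ j → (f i Fin.≟ f j) →-dec (i Fin.≟ j)) ×-dec
   (all? λ j → any? λ i → f i Fin.≟ j))

bijective-resp-≗ : ∀ {A B : Set} {f g : A → B} → f ≗ g →
  Bijective _≡_ _≡_ f → Bijective _≡_ _≡_ g
bijective-resp-≗ f≗g (inj , sur) =
  (λ {x} {y} eq → inj (trans (f≗g x) (trans eq (sym (f≗g y))))) ,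
  (λ y → let x , eq = sur y in x , λ z≡x → trans (sym (f≗g _)) (eq z≡x))

-- Neighbourhoods, and existence of the minimum number of weights.

module _ {n} (G : Graph n) where
  open Graph G
  open Inverse enumerate renaming (to to index; from to vertex)

  ∈-vertices : ∀ v → v ∈ vertices
  ∈-vertices v = subst (_∈ vertices) (strictlyInverseʳ v) (∈-map⁺ vertex (∈-allFin (index v)))

  vertices-unique : Unique vertices
  vertices-unique =
    Unique.map⁺ (Bijection.injective (↔⇒⤖ (↔-sym enumerate))) (Unique.allFin⁺ n)

  ∈-neighbours⁺ : ∀ {u v} → Adj u v → v ∈ neighbours u
  ∈-neighbours⁺ {u} {v} = ∈-filter⁺ (adj? u) (∈-vertices v)

  ∈-neighbours⁻ : ∀ {u v} → v ∈ neighbours u → Adj u v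
  ∈-neighbours⁻ {u} = proj₂ ∘ ∈-filter⁻ (adj? u) {xs = vertices}

  neighbours-unique : ∀ u → Unique (neighbours u)
  neighbours-unique u = Unique.filter⁺ (adj? u) vertices-unique

  weight-cong : ∀ (f g : Labeling G) → Bijection.to f ≗ Bijection.to g → weight G f ≗ weight G g
  weight-cong f g f≗g u = sum-map-cong (cong (suc ∘ toℕ) ∘ f≗g) (neighbours u)

  localDistanceAntimagic? : Decidable (LocalDistanceAntimagic G)
  localDistanceAntimagic? f = map′
    (λ w≢ {u} {v} → All.lookup (All.lookup w≢ (∈-vertices u)) (∈-vertices v))
    (λ w≢ → All.tabulate λ _ → All.tabulate λ _ → w≢)
    (All.all? (λ u → All.all? (λ v → adj? u v →-dec ¬? (weight G f u ℕ.≟ weight G f v))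
      vertices) vertices)

  -- Composition with `enumerate` turns labelings into bijections of `Fin n`. Invariance of `P`
  -- under pointwise equality also makes it independent of the proof of bijectivity.
  anyLabeling? : ∀ {P : Labeling G → Set} →
    (∀ f g → Bijection.to f ≗ Bijection.to g → P f → P g) → Decidable P → Dec (∃ P)
  anyLabeling? {P} resp P? = map′
    (λ (φ , bij , p) → labeling φ bij , p)
    (λ (f , p) →
      let module f = Bijection (f ⤖-∘ ↔⇒⤖ (↔-sym enumerate)) in
      f.to , f.bijective ,
      resp f _ (λ v → cong (Bijection.to f) (sym (strictlyInverseʳ v))) p)
    (anyVector? n
      (λ φ≗ψ (bij , p) → bijective-resp-≗ φ≗ψ bij , resp _ _ (φ≗ψ ∘ index) p)
      decide)
    where
    labeling : ∀ φ → Bijective _≡_ _≡_ φ → Labeling G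
    labeling φ bij = mk⤖ {to = φ} bij ⤖-∘ ↔⇒⤖ enumerate

    decide : Decidable λ φ → ∃[ bij ] P (labeling φ bij)
    decide φ with bijective? φ
    ... | no ¬bij = no (¬bij ∘ proj₁)
    -- A witness may carry another proof of bijectivity than `bij`; the underlying functions
    -- coincide, so `resp` applies with `refl`.
    ... | yes bij = map′ (bij ,_) (λ (_ , p) → resp _ _ (λ _ → refl) p) (P? (labeling φ bij))

  -- The number of weights of the given labeling bounds the search for the least attained number.
  χld-exists : HasLocalDistanceAntimagicLabeling G → ∃[ k ] χld G ≔ k
  χld-exists (f , f-lda) =
    let k , attained , k-min = least P? (numberOfWeights G f) (f , f-lda , refl) in
    k , record { attained = attained ; lowerBound = λ g g-lda → k-min _ (g , g-lda , refl) }
    where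
    P? : Decidable λ k → ∃[ f ] LocalDistanceAntimagic G f × numberOfWeights G f ≡ k
    P? k = anyLabeling?
      (λ f g f≗g (lda , eq) →
        (λ {u} {v} adj w≡ → lda adj
          (trans (weight-cong f g f≗g u) (trans w≡ (sym (weight-cong f g f≗g v))))) ,
        trans (cong (length ∘ deduplicate ℕ._≟_)
          (map-cong (sym ∘ weight-cong f g f≗g) vertices)) eq)
      (λ f → localDistanceAntimagic? f ×-dec (numberOfWeights G f ℕ.≟ k))

-- Degrees and neighbourhoods in the factors and the product.

-- Needed to cancel the factor r m from weights. The vertex `h` has a neighbour; it is an argument
-- because an empty graph is regular of every degree.
degree-nonZero : ∀ {m} r (H : Graph m) → Regular r H → Graph.V H → NonZero r
degree-nonZero zero H regular h
  with Graph.neighbours H h | regular h | ∈-neighbours⁺ H (proj₂ (Graph.noIsolated H h))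
... | [] | _ | ()
degree-nonZero (suc _) _ _ _ = _

-- Both lists are free of repetitions and have the same members. A permutation suffices because only
-- sums over them are taken.
neighbours-×ᴳ : ∀ {n m} (G : Graph n) (H : Graph m) u h →
  Graph.neighbours (G ×ᴳ H) (u , h) ↭
  cartesianProduct (Graph.neighbours G u) (Graph.neighbours H h)
neighbours-×ᴳ G H u h = ∼bag⇒↭ $ unique∧set⇒bag
  (neighbours-unique (G ×ᴳ H) (u , h))
  (Unique.cartesianProduct⁺ (neighbours-unique G u) (neighbours-unique H h))
  (mk⇔
    (λ x∈ → let a , b = ∈-neighbours⁻ (G ×ᴳ H) x∈ in
      ∈-cartesianProduct⁺ (∈-neighbours⁺ G a) (∈-neighbours⁺ H b))
    (λ x∈ → let a , b = ∈-cartesianProduct⁻ (Graph.neighbours G u) (Graph.neighbours H h) x∈ in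
      ∈-neighbours⁺ (G ×ᴳ H) (∈-neighbours⁻ G a , ∈-neighbours⁻ H b)))

-- Reversing positions according to color.

flipUnless : ∀ {m} → Bool → Fin m → Fin m
flipUnless b i = if b then i else opposite i

flipUnless-involutive : ∀ {m} b (i : Fin m) → flipUnless b (flipUnless b i) ≡ i
flipUnless-involutive true  i = refl
flipUnless-involutive false i = opposite-involutive i

flipUnless-injective : ∀ {m} b {i j : Fin m} → flipUnless b i ≡ flipUnless b j → i ≡ j
flipUnless-injective b {i} {j} eq = begin
  i                              ≡⟨ flipUnless-involutive b i ⟨
  flipUnless b (flipUnless b i)  ≡⟨ cong (flipUnless b) eq ⟩
  flipUnless b (flipUnless b j)  ≡⟨ flipUnless-involutive b j ⟩
  j                              ∎
  where open ≡-Reasoning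

suc-toℕ+suc-opposite : ∀ {m} (i : Fin m) → suc (toℕ i) + suc (toℕ (opposite i)) ≡ suc m
suc-toℕ+suc-opposite {m} i = begin
  suc (toℕ i) + suc (toℕ (opposite i))  ≡⟨ +-suc (suc (toℕ i)) _ ⟩
  suc (suc (toℕ i) + toℕ (opposite i))  ≡⟨ cong (λ x → suc (suc (toℕ i) + x)) (opposite-prop i) ⟩
  suc (suc (toℕ i) + (m ∸ suc (toℕ i))) ≡⟨ cong suc (m+[n∸m]≡n (toℕ<n i)) ⟩
  suc m                                 ∎
  where open ≡-Reasoning

-- The labeling of the product and its weights.

module _ {n m} (G : Graph n) (H : Graph m) (c : Graph.V G → Bool) (f : Labeling G) where
  private
    module G = Graph G
    module H = Graph H
    module f = Bijection f
    module j = Bijection (↔⇒⤖ H.enumerate)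

  position : Bool → H.V → Fin m
  position b h = flipUnless b (j.to h)

  -- `combine` writes the value in base m: `f` gives the leading digit and the position of `h`,
  -- reversed or not, gives the last one.
  productLabeling : Labeling (G ×ᴳ H)
  productLabeling = mk⤖ (injective , strictlySurjective⇒surjective surjective)
    where
    to : G.V × H.V → Fin (n * m)
    to (v , h) = combine (f.to v) (position (c v) h)

    injective : Injective _≡_ _≡_ to
    injective {v , h} {v′ , h′} eq
      with combine-injective (f.to v) _ (f.to v′) _ eq
    -- The leading digit determines the vertex of G, hence the color, so both positions are flipped
    -- in the same way.
    ... | fv≡fv′ , p≡p′ with refl ← f.injective fv≡fv′ =
      cong (v ,_) (j.injective (flipUnless-injective (c v) p≡p′))

    surjective : StrictlySurjective _≡_ to
    surjective k with combine-surjective {n} {m} k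
    ... | i , p , refl with f.strictlySurjective i
    -- Since the flip is its own inverse, the vertex of H at the flipped position receives the last
    -- digit `p`.
    ...   | v , refl with j.strictlySurjective (flipUnless (c v) p)
    ...     | h , jh≡ = (v , h) , cong (combine (f.to v))
      (trans (cong (flipUnless (c v)) jh≡) (flipUnless-involutive (c v) p))

  -- Labels start at 1, so the leading digit is one less than `label G f v`; adding m makes up for
  -- this without subtraction.
  label-product : ∀ v h → label (G ×ᴳ H) productLabeling (v , h) + m ≡
    m * label G f v + suc (toℕ (position (c v) h))
  label-product v h = trans
    (cong (λ x → suc x + m) (toℕ-combine (f.to v) (position (c v) h)))
    (rearrange m (toℕ (f.to v)) (toℕ (position (c v) h)))
    where
    rearrange : ∀ m a p → suc (m * a + p) + m ≡ m * suc a + suc p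
    rearrange = solve-∀

  positionSum : H.V → Bool → ℕ
  positionSum h b = sum (map (λ x → suc (toℕ (position b x))) (H.neighbours h))

  -- Each neighbour of `h` contributes its position and the reversed one, both counted from 1,
  -- together m + 1.
  positionSum-total : ∀ h → positionSum h true + positionSum h false ≡ H.degree h * suc m
  positionSum-total h = begin
    positionSum h true + positionSum h false
      ≡⟨ sum-map-+ _ _ (H.neighbours h) ⟨
    sum (map (λ x → suc (toℕ (j.to x)) + suc (toℕ (opposite (j.to x)))) (H.neighbours h))
      ≡⟨ sum-map-cong (λ x → suc-toℕ+suc-opposite (j.to x)) (H.neighbours h) ⟩
    sum (map (λ _ → suc m) (H.neighbours h))
      ≡⟨ sum-map-const (suc m) (H.neighbours h) ⟩
    H.degree h * suc m ∎
    where open ≡-Reasoning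

  layerSum : H.V → G.V → ℕ
  layerSum h v = sum (map (λ x → label (G ×ᴳ H) productLabeling (v , x)) (H.neighbours h))

  -- Sums `label-product` over the neighbours of `h`. Apart from its label, `v` enters the result
  -- only through its color.
  layerSum-affine : ∀ h v → layerSum h v + H.degree h * m ≡
    H.degree h * m * label G f v + positionSum h (c v)
  layerSum-affine h v = begin
    layerSum h v + d * m
      ≡⟨ cong (layerSum h v +_) (sum-map-const m N) ⟨
    layerSum h v + sum (map (λ _ → m) N)
      ≡⟨ sum-map-+ _ _ N ⟨
    sum (map (λ x → label (G ×ᴳ H) productLabeling (v , x) + m) N)
      ≡⟨ sum-map-cong (label-product v) N ⟩
    sum (map (λ x → m * label G f v + suc (toℕ (position (c v) x))) N)
      ≡⟨ sum-map-+ _ _ N ⟩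
    sum (map (λ _ → m * label G f v) N) + positionSum h (c v)
      ≡⟨ cong (_+ positionSum h (c v)) (sum-map-const _ N) ⟩
    d * (m * label G f v) + positionSum h (c v)
      ≡⟨ cong (_+ positionSum h (c v)) (ℕ.*-assoc d m _) ⟨
    d * m * label G f v + positionSum h (c v) ∎
    where
    open ≡-Reasoning
    N = H.neighbours h
    d = H.degree h

  -- The constant 2trm is moved to the left to avoid truncated subtraction.
  weight-product : ∀ {t r} → Regular (2 * t) G → NeighbourhoodBalanced G c → Regular r H →
    ∀ u h → weight (G ×ᴳ H) productLabeling (u , h) + 2 * t * (r * m) ≡
            r * m * weight G f u + t * (r * suc m)
  weight-product {t} {r} G-regular balanced H-regular u h = begin
    weight (G ×ᴳ H) productLabeling (u , h) + 2 * t * (r * m)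
      ≡⟨ cong₂ _+_
           (trans (sum-↭ (↭.map⁺ _ (neighbours-×ᴳ G H u h))) (sum-map-cartesianProduct _ N _))
           (cong₂ (λ a b → a * (b * m)) (sym (G-regular u)) (sym (H-regular h))) ⟩
    sum (map (layerSum h) N) + length N * (d * m)
      ≡⟨ cong (sum (map (layerSum h) N) +_) (sum-map-const (d * m) N) ⟨
    sum (map (layerSum h) N) + sum (map (λ _ → d * m) N)
      ≡⟨ sum-map-+ _ _ N ⟨
    sum (map (λ v → layerSum h v + d * m) N)
      ≡⟨ sum-map-cong (layerSum-affine h) N ⟩
    sum (map (λ v → d * m * label G f v + positionSum h (c v)) N)
      ≡⟨ sum-map-+ _ _ N ⟩
    sum (map (λ v → d * m * label G f v) N) + sum (map (positionSum h ∘ c) N)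
      ≡⟨ cong₂ _+_ (sum-map-* (d * m) _ N) (sum-map-colored c (positionSum h) N) ⟩
    d * m * weight G f u + (number true * positionSum h true + number false * positionSum h false)
      -- Balance gives both colors the coefficient t, so the two position sums can be merged into
      -- their constant total.
      ≡⟨ cong (d * m * weight G f u +_)
           (cong₂ (λ a b → a * positionSum h true + b * positionSum h false) true≡t
             (trans (sym (balanced u)) true≡t)) ⟩
    d * m * weight G f u + (t * positionSum h true + t * positionSum h false)
      ≡⟨ cong (d * m * weight G f u +_) (*-distribˡ-+ t _ _) ⟨
    d * m * weight G f u + t * (positionSum h true + positionSum h false)
      ≡⟨ cong (λ x → d * m * weight G f u + t * x) (positionSum-total h) ⟩
    d * m * weight G f u + t * (d * suc m)
      ≡⟨ cong (λ d → d * m * weight G f u + t * (d * suc m)) (H-regular h) ⟩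
    r * m * weight G f u + t * (r * suc m) ∎
    where
    open ≡-Reasoning
    N = G.neighbours u
    d = H.degree h

    number : Bool → ℕ
    number b = length (colored c b N)

    -- The 2t neighbours of `u` are split evenly between the two colors.
    true≡t : number true ≡ t
    true≡t = *-cancelˡ-≡ _ _ 2 (begin
      2 * number true             ≡⟨ cong (number true +_) (+-identityʳ _) ⟩
      number true + number true   ≡⟨ cong (number true +_) (balanced u) ⟩
      number true + number false  ≡⟨ length-colored c N ⟨
      length N                    ≡⟨ G-regular u ⟩
      2 * t                       ∎)

  -- Antimagic property and number of weights of the product labeling.

  module _ {t r} (G-regular : Regular (2 * t) G) (balanced : NeighbourhoodBalanced G c)
           (H-regular : Regular r H) where

    private
      weights : ∀ u h → weight (G ×ᴳ H) productLabeling (u , h) + 2 * t * (r * m) ≡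
                        r * m * weight G f u + t * (r * suc m)
      weights = weight-product {t} {r} G-regular balanced H-regular

    -- Product weights are an injective affine function of the weights of `f`, and adjacent vertices
    -- of the product have adjacent first components.
    productLabeling-antimagic :
      LocalDistanceAntimagic G f → LocalDistanceAntimagic (G ×ᴳ H) productLabeling
    productLabeling-antimagic f-lda {u , h} {v , h′} (u~v , _) eq = f-lda u~v
      (*-cancelˡ-≡ _ _ (r * m) {{rm≢0}} (+-cancelʳ-≡ (t * (r * suc m)) _ _ (begin
        r * m * weight G f u + t * (r * suc m)  ≡⟨ weights u h ⟨
        weight (G ×ᴳ H) productLabeling (u , h) + 2 * t * (r * m)
                                                ≡⟨ cong (_+ 2 * t * (r * m)) eq ⟩
        weight (G ×ᴳ H) productLabeling (v , h′) + 2 * t * (r * m)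
                                                ≡⟨ weights v h′ ⟩
        r * m * weight G f v + t * (r * suc m)  ∎)))
      where
      open ≡-Reasoning
      rm≢0 : NonZero (r * m)
      -- The vertex `h` shows both that r is nonzero and, through its index in `Fin m`, that m is.
      rm≢0 = m*n≢0 r m {{degree-nonZero r H H-regular h}} {{nonZeroIndex (j.to h)}}

    -- Every weight of the product is the image under one function `φ` of a weight of `f`.
    numberOfWeights-product : numberOfWeights (G ×ᴳ H) productLabeling ≤ numberOfWeights G f
    numberOfWeights-product = subst (numberOfWeights (G ×ᴳ H) productLabeling ≤_)
      (length-map φ G-weights)
      (unique-⊆⇒length-≤ ℕ._≟_ (DecUnique.deduplicate-! ℕ._≟_ _) weights⊆)
      where
      G-weights = deduplicate ℕ._≟_ (map (weight G f) G.vertices)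

      φ : ℕ → ℕ
      -- At the weight of a vertex of G the truncation is harmless: `weights` exhibits the
      -- subtracted constant as a summand.
      φ w = r * m * w + t * (r * suc m) ∸ 2 * t * (r * m)

      φ-weight : ∀ u h → φ (weight G f u) ≡ weight (G ×ᴳ H) productLabeling (u , h)
      φ-weight u h = trans (cong (_∸ 2 * t * (r * m)) (sym (weights u h)))
                           (m+n∸n≡m _ (2 * t * (r * m)))

      weights⊆ : deduplicate ℕ._≟_
        (map (weight (G ×ᴳ H) productLabeling) (Graph.vertices (G ×ᴳ H))) ⊆ map φ G-weights
      weights⊆ w∈ with ∈-map⁻ _ (∈-deduplicate⁻ ℕ._≟_ _ w∈)
      ... | (u , h) , _ , refl = subst (_∈ map φ G-weights) (φ-weight u h)
        (∈-map⁺ φ (∈-deduplicate⁺ ℕ._≟_ (∈-map⁺ (weight G f) (∈-vertices G u))))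

theorem5p1 : ∀ {n m : ℕ} (G : Graph n) (H : Graph m) (t r : ℕ) →
    Regular (2 * t) G →
    HasNeighbourhoodBalancedColoring G →
    HasLocalDistanceAntimagicLabeling G →
    Regular r H →
    ∃[ k ] ∃[ l ] (χld (G ×ᴳ H) ≔ k) × (χld G ≔ l) × k ≤ l
theorem5p1 G H t r G-regular (c , balanced) G-lda H-regular
  with χld-exists G G-lda
... | l , χG≔l with χld_≔_.attained χG≔l
-- `f` is chosen to attain the minimum for G, and `refl` identifies `l` with its number of weights.
... | f , f-lda , refl = k , l , χ≔k , χG≔l ,
  ≤-trans (χld_≔_.lowerBound χ≔k g g-lda)
          (numberOfWeights-product G H c f {t} {r} G-regular balanced H-regular)
  where
  g = productLabeling G H c f

  g-lda : LocalDistanceAntimagic (G ×ᴳ H) g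
  g-lda = productLabeling-antimagic G H c f {t} {r} G-regular balanced H-regular f-lda

  product-χld = χld-exists (G ×ᴳ H) (g , g-lda)
  k = proj₁ product-χld
  χ≔k = proj₂ product-χld
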